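{- Let $a,b,c\in\mathbf{Z}$ and $d=b^2-4ac$. Let $p$ be an odd prime and let $i\in\mathbf{Z}$, $i\geq 2$. If $\gcd(a,p^i)=p^l$ with $1\leq l<i$, then IQF is valid for $ax^2+bx+c\equiv 0\bmod p^i$ if and only if either (a) $d$ is a quadratic non-residue of $p^i$, or (b) $d$ is a quadratic residue of $p^i$ and exactly one of the following mutually exclusive conditions holds: (i) $l>1$, $b$ is divisible by $p$, and $(p^i,p^l)$ forms a $(b,d)$-obstruction; (ii) $l=1$, $i$ is odd, $b$ and $c$ are divisible by $p$, and $d$ is divisible by $p^{i+1}$.
   Context: IQF (the intermediate form of the quadratic formula) is valid for $ax^2+bx+c\equiv 0\bmod n$, with $d=b^2-4ac$, if for every integer $x$: $ax^2+bx+c\equiv 0\bmod n$ if and only if there is an integer $s$ with $s^2\equiv d\bmod n$ and $2ax\equiv -b+s\bmod n$. An integer $u$ is a quadratic residue of a positive integer $v$ if $x^2\equiv u\bmod v$ has an integer solution (no coprimality is required), and a quadratic non-residue of $v$ otherwise. The multiplicity of a prime $p$ in a nonzero integer $z$ is the largest $e\geq 0$ with $p^e\mid z$. $(b,d)$-obstruction: let $p$ be a prime, $\alpha,\beta$ positive integers, $b,d$ integers. The pair $(p^{\alpha},p^{\beta})$ forms a $(b,d)$-obstruction if one of the following holds: (1) $d$ is not divisible by $p^{\alpha}$, the multiplicity of $p$ in $d$ is even, say $2\mu$, and, writing $d=d_1p^{2\mu}$ and letting $\Sigma$ be the set of all solutions $\sigma$, $0\leq\sigma<p^{\alpha-2\mu}$,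 of $x^2\equiv d_1\bmod p^{\alpha-2\mu}$, one has $\sigma p^{\mu}+jp^{\alpha-\mu}\not\equiv b\bmod p^{\beta}$ for all $\sigma\in\Sigma$ and all $j\in\{0,1,\dots,p^{\mu}-1\}$; (2) $d$ is divisible by $p^{\alpha}$ and, with $s$ chosen so that $\alpha=2s$ if $\alpha$ is even and $\alpha=2s-1$ if $\alpha$ is odd, one has $jp^{s}\not\equiv b\bmod p^{\beta}$ for all $j\in\{0,1,\dots,p^{\alpha-s}-1\}$. -}

module Defs where

open import Data.Integer.Base using (ℤ; +_; _+_; _*_; _-_; -_; 0ℤ)
open import Data.Integer.Divisibility.Signed using (_∣_)
open import Data.Nat.Base as ℕ using (ℕ; suc; _^_; _∸_)
open import Data.Product.Base using (_×_; ∃-syntax)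
open import Data.Sum.Base using (_⊎_)
open import Function.Bundles using (_⇔_)
open import Relation.Binary.PropositionalEquality.Core using (_≡_)
open import Relation.Nullary.Negation.Core using (¬_)

infix 4 _≡_[mod_] _≢_[mod_]

_≡_[mod_] : ℤ → ℤ → ℕ → Set
x ≡ y [mod n ] = + n ∣ x - y

_≢_[mod_] : ℤ → ℤ → ℕ → Set
x ≢ y [mod n ] = ¬ (x ≡ y [mod n ])

disc : ℤ → ℤ → ℤ → ℤ
disc a b c = b * b - + 4 * a * c

IQFValid : ℤ → ℤ → ℤ → ℕ → Set
IQFValid a b c n =
  ∀ (x : ℤ) →
    (a * (x * x) + b * x + c ≡ 0ℤ [mod n ])
    ⇔ (∃[ s ] ((s * s ≡ disc a b c [mod n ])
             × (+ 2 * a * x ≡ - b + s [mod n ])))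

-- No coprimality of u and v is required.
QuadraticResidue : ℤ → ℕ → Set
QuadraticResidue u v = ∃[ x ] (x * x ≡ u [mod v ])

QuadraticNonResidue : ℤ → ℕ → Set
QuadraticNonResidue u v = ¬ QuadraticResidue u v

-- For p ≥ 2, Multiplicity p z e has no solution e when z is 0.
Multiplicity : ℕ → ℤ → ℕ → Set
Multiplicity p z e =
  (+ (p ^ e) ∣ z) × (∀ k → + (p ^ k) ∣ z → k ℕ.≤ e)

-- In the obstructions below, p is meant to be prime, α and β to be positive.

-- The truncated subtractions lose nothing: as p ^ α does not divide d, 2 * μ < α.
ObstructionNonDiv : (p α β : ℕ) (b d : ℤ) → Set
ObstructionNonDiv p α β b d =
  (¬ (+ (p ^ α) ∣ d))
  × ∃[ μ ] ∃[ d₁ ]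
      ( Multiplicity p d (2 ℕ.* μ)
      × (d ≡ d₁ * + (p ^ (2 ℕ.* μ)))
      × (∀ (σ j : ℕ) →
           σ ℕ.< p ^ (α ∸ 2 ℕ.* μ) →
           (+ σ * + σ ≡ d₁ [mod p ^ (α ∸ 2 ℕ.* μ) ]) →
           j ℕ.< p ^ μ →
           + (σ ℕ.* p ^ μ ℕ.+ j ℕ.* p ^ (α ∸ μ)) ≢ b [mod p ^ β ]))

-- The two alternatives for s are α = 2s (α even) and α = 2s - 1 (α odd), so
-- that s is determined by α; in particular s ≤ α.
ObstructionDiv : (p α β : ℕ) (b d : ℤ) → Set
ObstructionDiv p α β b d =
  (+ (p ^ α) ∣ d)
  × ∃[ s ]
      ( (α ≡ 2 ℕ.* s ⊎ suc α ≡ 2 ℕ.* s)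
      × (∀ (j : ℕ) →
           j ℕ.< p ^ (α ∸ s) →
           + (j ℕ.* p ^ s) ≢ b [mod p ^ β ]))

-- The pair (p ^ α , p ^ β) forms a (b , d)-obstruction.
Obstruction : (p α β : ℕ) (b d : ℤ) → Set
Obstruction p α β b d = ObstructionNonDiv p α β b d ⊎ ObstructionDiv p α β b d

ExactlyOne : Set → Set → Set
ExactlyOne P Q = (P ⊎ Q) × ¬ (P × Q)

{-# OPTIONS --safe #-}

-- Write f(x) = ax² + bx + c and S(x) = 2ax + b, so that S(x)² − d = 4a f(x), and let i = l + m,
-- a = a'pˡ. Since p is odd, IQF is valid mod pⁱ iff pᵐ ∣ f(x) implies pⁱ ∣ f(x) for every x.
-- The x with pᵐ ∣ f(x) correspond to the square roots s of d mod pⁱ with s ≡ b mod pˡ, and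
-- an obstruction says exactly that there is no such s. So one has to see when the implication
-- can hold non-vacuously. Comparing f(x) and f(x + h) = f(x) + h(S + ah), the implication
-- gives first pˡ ∣ S (take h = pᵐ), say S = S'pˡ, and then that the valuation of h(S' + a'h) is
-- never in [m − l, m). Powers of p for h force high powers of p to divide S'. If the interval
-- contains an even number 2k, taking h = pᵏ and h = 2pᵏ then gives a contradiction. The only
-- remaining case is l = 1 with m even, in which pⁱ⁺¹ divides S² and hence d.

module Submission where

open import Defs
open import Data.Empty using (⊥)
open import Data.Integer.Base using (ℤ; +_; _+_; _*_; _-_; -_; ∣_∣; 0ℤ; 1ℤ)
open import Data.Integer.DivMod using (_%ℕ_; _/ℕ_; n%ℕd<d; a≡a%ℕn+[a/ℕn]*n)
open import Data.Integer.Divisibility.Signed using (_∣_; divides; _∣?_; ∣ᵤ⇒∣; ∣⇒∣ᵤ; ∣-refl; ∣-trans; ∣m∣n⇒∣m+n; ∣m∣n⇒∣m-n; ∣m+n∣m⇒∣n; ∣m+n∣n⇒∣m; ∣m⇒∣m*n; ∣n⇒∣m*n; *-monoʳ-∣; *-cancelˡ-∣)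
open import Data.Integer.GCD using (gcd; gcd[i,j]∣i; gcd-greatest)
open import Data.Integer.Properties as ℤ using (pos-*; pos-+; abs-*; +∣i∣≡i⊎+∣i∣≡-i)
open import Data.Integer.Tactic.RingSolver using (solve-∀)
open import Data.Nat.Base as ℕ using (ℕ; zero; suc; _^_; _∸_; _≤_; _<_; z≤n; s≤s; s≤s⁻¹)
open import Data.Nat.Coprimality using (Coprime; coprime-Bézout)
open import Data.Nat.Divisibility using () renaming (_∣_ to _∣ⁿ_; _∤_ to _∤ⁿ_; divides to dividesⁿ; ∣⇒≤ to ∣ⁿ⇒≤)
open import Data.Nat.GCD using (module Bézout)
open import Data.Nat.Primality using (Prime; prime⇒nonZero; prime⇒nonTrivial; prime⇒irreducible; euclidsLemma)
import Data.Nat.Properties as ℕ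
open import Data.Product.Base using (_×_; _,_; ∃-syntax)
open import Data.Sum.Base as Sum using (_⊎_; inj₁; inj₂)
open import Function.Bundles using (_⇔_; mk⇔; module Equivalence)
open import Relation.Binary.PropositionalEquality.Core using (_≡_; refl; sym; trans; cong; cong₂; subst)
open import Relation.Nullary.Decidable.Core using (Dec; yes; no; map′)
open import Relation.Nullary.Negation.Core using (¬_; contradiction)

-- Divisibility, parity and decidability of quadratic residues.

∣-resp-≡ : ∀ {k x y} → x ≡ y → k ∣ x → k ∣ y
∣-resp-≡ {k} = subst (k ∣_)

∣-resp-≡ˡ : ∀ {j k} z → j ≡ k → j ∣ z → k ∣ z
∣-resp-≡ˡ z = subst (_∣ z)

x-y+y≡x : ∀ x y → x - y + y ≡ x
x-y+y≡x = solve-∀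

x-[x-y]≡y : ∀ x y → x - (x - y) ≡ y
x-[x-y]≡y = solve-∀

double : ∀ n → 2 ℕ.* n ≡ n ℕ.+ n
double n = cong (n ℕ.+_) (ℕ.+-identityʳ n)

parity : ∀ n → ∃[ k ] (n ≡ k ℕ.+ k ⊎ n ≡ suc (k ℕ.+ k))
parity zero = 0 , inj₁ refl
parity (suc n) with parity n
... | k , inj₁ n≡2k = k , inj₂ (cong suc n≡2k)
... | k , inj₂ n≡2k+1 = suc k , inj₁ (cong suc (trans n≡2k+1 (sym (ℕ.+-suc k k))))

2∣double : ∀ k → 2 ∣ⁿ k ℕ.+ k
2∣double k = dividesⁿ k (trans (sym (double k)) (ℕ.*-comm 2 k))

2∤suc-double : ∀ k → 2 ∤ⁿ suc (k ℕ.+ k)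
2∤suc-double k (dividesⁿ q eq) =
  ℕ.even≢odd q k (trans (ℕ.*-comm 2 q) (trans (sym eq) (cong suc (sym (double k)))))

-- Reducing a root modulo `v` leaves a root, so a search below `v` decides. This makes the later
-- case distinction constructive.
quadraticResidue? : ∀ u v .{{_ : ℕ.NonZero v}} → Dec (QuadraticResidue u v)
quadraticResidue? u v = map′ (λ (n , _ , h) → + n , h) bounded
                             (ℕ.anyUpTo? (λ n → + v ∣? (+ n * + n - u)) v)
  where
  bounded : QuadraticResidue u v → ∃[ n ] (n < v × + v ∣ + n * + n - u)
  bounded (x , h) = x %ℕ v , n%ℕd<d x v ,
    ∣m+n∣n⇒∣m (∣-resp-≡ eq h) (∣n⇒∣m*n (q * (+ 2 * r + q * + v)) ∣-refl)
    where
    r = + (x %ℕ v)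
    q = x /ℕ v
    ring : ∀ r q v u → (r + q * v) * (r + q * v) - u ≡ r * r - u + q * (+ 2 * r + q * v) * v
    ring = solve-∀
    eq : x * x - u ≡ r * r - u + q * (+ 2 * r + q * + v) * + v
    eq = trans (cong (λ y → y * y - u) (a≡a%ℕn+[a/ℕn]*n x v)) (ring r q (+ v) u)

-- Divisibility by powers of a prime.

module PrimePowers {p : ℕ} (p-prime : Prime p) where

  instance
    p≢0 : ℕ.NonZero p
    p≢0 = prime⇒nonZero p-prime

  1<p : 1 < p
  1<p = ℕ.nonTrivial⇒n>1 p {{prime⇒nonTrivial p-prime}}

  P : ℕ → ℤ
  P k = + (p ^ k)

  p^k≢0 : ∀ k → ℕ.NonZero (p ^ k)
  p^k≢0 k = ℕ.m^n≢0 p k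

  divMod-P : ∀ k z → ∃[ r ] ∃[ q ] (r < p ^ k × z ≡ + r + q * P k)
  divMod-P k z = z %ℕ p ^ k , z /ℕ p ^ k , n%ℕd<d z (p ^ k) , a≡a%ℕn+[a/ℕn]*n z (p ^ k)
    where instance p^k≢0ᵢ = p^k≢0 k

  P-+ : ∀ m n → P (m ℕ.+ n) ≡ P m * P n
  P-+ m n = trans (cong +_ (ℕ.^-distribˡ-+-* p m n)) (pos-* (p ^ m) (p ^ n))

  P-1 : P 1 ≡ + p
  P-1 = cong +_ (ℕ.*-identityʳ p)

  P-0-∣ : ∀ z → P 0 ∣ z
  P-0-∣ z = divides z (sym (ℤ.*-identityʳ z))

  P-∣-P* : ∀ k z → P k ∣ P k * z
  P-∣-P* k z = divides z (ℤ.*-comm (P k) z)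

  P-mono : ∀ {m n} → m ≤ n → P m ∣ P n
  P-mono {m} m≤n with o , refl ← ℕ.m≤n⇒∃[o]m+o≡n m≤n =
    divides (P o) (trans (P-+ m o) (ℤ.*-comm (P m) (P o)))

  p∣P : ∀ {n} → 1 ≤ n → + p ∣ P n
  p∣P {n} 1≤n = subst (_∣ P n) P-1 (P-mono 1≤n)

  P-scale : ∀ k n {z} → P n ∣ z → P (k ℕ.+ n) ∣ P k * z
  P-scale k n {z} h = ∣-resp-≡ˡ (P k * z) (sym (P-+ k n)) (*-monoʳ-∣ (P k) h)

  P-cancel : ∀ k n {z} → P (k ℕ.+ n) ∣ P k * z → P n ∣ z
  P-cancel k n {z} h = *-cancelˡ-∣ (P k) {{p^k≢0 k}} (∣-resp-≡ˡ (P k * z) (P-+ k n) h)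

  P-suc : ∀ k → P (suc k) ≡ P k * + p
  P-suc k = trans (pos-* p (p ^ k)) (ℤ.*-comm (+ p) (P k))

  P-suc-scale : ∀ k {z} → + p ∣ z → P (suc k) ∣ P k * z
  P-suc-scale k {z} h = ∣-resp-≡ˡ (P k * z) (sym (P-suc k)) (*-monoʳ-∣ (P k) h)

  P-suc-cancel : ∀ k {z} → P (suc k) ∣ P k * z → + p ∣ z
  P-suc-cancel k {z} h = *-cancelˡ-∣ (P k) {{p^k≢0 k}} (∣-resp-≡ˡ (P k * z) (P-suc k) h)

  p∣x*y⇒p∣x⊎p∣y : ∀ x y → + p ∣ x * y → (+ p ∣ x) ⊎ (+ p ∣ y)
  p∣x*y⇒p∣x⊎p∣y x y h =
    Sum.map ∣ᵤ⇒∣ ∣ᵤ⇒∣ (euclidsLemma ∣ x ∣ ∣ y ∣ p-prime (subst (p ∣ⁿ_) (abs-* x y) (∣⇒∣ᵤ h)))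

  p∣x²⇒p∣x : ∀ x → + p ∣ x * x → + p ∣ x
  p∣x²⇒p∣x x h = Sum.[ (λ z → z) , (λ z → z) ] (p∣x*y⇒p∣x⊎p∣y x x h)

  p∤u∧p∣u*z⇒p∣z : ∀ u z → ¬ (+ p ∣ u) → + p ∣ u * z → + p ∣ z
  p∤u∧p∣u*z⇒p∣z u z p∤u h = Sum.[ (λ p∣u → contradiction p∣u p∤u) , (λ p∣z → p∣z) ] (p∣x*y⇒p∣x⊎p∣y u z h)

  -- By induction `z = q * P k`; once `P k` is cancelled, primality moves the one remaining factor
  -- `p` from `u * q` to `q`.
  P-coprime-cancel : ∀ u {z} k → ¬ (+ p ∣ u) → P k ∣ u * z → P k ∣ z
  P-coprime-cancel u {z} zero p∤u h = P-0-∣ z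
  P-coprime-cancel u {z} (suc k) p∤u h
    with divides q refl ← P-coprime-cancel u {z} k p∤u (∣-trans (P-mono (ℕ.n≤1+n k)) h) =
    ∣-resp-≡ (ℤ.*-comm (P k) q)
      (P-suc-scale k (p∤u∧p∣u*z⇒p∣z u q p∤u (P-suc-cancel k (∣-resp-≡ (ring u q (P k)) h))))
    where
    ring : ∀ u q A → u * (q * A) ≡ A * (u * q)
    ring = solve-∀

  -- The valuation of a square is even. Hence the bound `suc n`: an odd `n = 2k - 1` already yields
  -- `p ^ k`.
  P-∣-square⇒P-∣ : ∀ k {n} s → k ℕ.+ k ≤ suc n → P n ∣ s * s → P k ∣ s
  P-∣-square⇒P-∣ zero s _ _ = P-0-∣ s
  P-∣-square⇒P-∣ (suc k) {n} s 2k+2≤n+1 h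
    with 2k<n ← subst (_≤ n) (ℕ.+-suc k k) (s≤s⁻¹ 2k+2≤n+1)
    with divides q refl ← P-∣-square⇒P-∣ k {n} s (ℕ.≤-trans (ℕ.<⇒≤ 2k<n) (ℕ.n≤1+n n)) h =
    ∣-resp-≡ (ℤ.*-comm (P k) q) (P-suc-scale k (p∣x²⇒p∣x q (P-suc-cancel (k ℕ.+ k)
      (∣-resp-≡ (trans (ring q (P k)) (cong (_* (q * q)) (sym (P-+ k k))))
        (∣-trans (P-mono 2k<n) h)))))
    where
    ring : ∀ q A → q * A * (q * A) ≡ A * A * (q * q)
    ring = solve-∀

  P-∣⇒P-∣-square : ∀ k s → P k ∣ s → P (k ℕ.+ k) ∣ s * s
  P-∣⇒P-∣-square k _ (divides q refl) =
    ∣-resp-≡ˡ (q * P k * (q * P k)) (sym (P-+ k k)) (divides (q * q) (ring q (P k)))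
    where
    ring : ∀ q A → q * A * (q * A) ≡ q * q * (A * A)
    ring = solve-∀

  -- Non-divisibility by `P n` excludes `s = 0` and bounds the search for the valuation.
  p-adic-factorisation : ∀ n s → ¬ (P n ∣ s) → ∃[ μ ] ∃[ t ] (s ≡ t * P μ × ¬ (+ p ∣ t))
  p-adic-factorisation zero s h = contradiction (P-0-∣ s) h
  p-adic-factorisation (suc n) s h with P n ∣? s
  ... | no ∤s = p-adic-factorisation n s ∤s
  ... | yes (divides t s≡) = n , t , s≡ ,
    λ p∣t → h (∣-resp-≡ (trans (ℤ.*-comm (P n) t) (sym s≡)) (P-suc-scale n p∣t))

  -- Inverses modulo p and Hensel lifting.

  inverse-mod-p : ∀ u → ¬ (+ p ∣ u) → ∃[ w ] (+ p ∣ u * w - 1ℤ)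
  inverse-mod-p u p∤u with natural (coprime-Bézout coprime)
    where
    coprime : Coprime ∣ u ∣ p
    coprime (d∣u , d∣p) with prime⇒irreducible p-prime d∣p
    ... | inj₁ d≡1 = d≡1
    ... | inj₂ refl = contradiction (∣ᵤ⇒∣ d∣u) p∤u
    natural : ∀ {n} → Bézout.Identity 1 n p → ∃[ w ] (+ p ∣ + n * w - 1ℤ)
    natural {n} (Bézout.+- x y eq) = + x , divides (+ y) (trans (cong (_- 1ℤ) nx) (ring (+ y * + p)))
      where
      nx : + n * + x ≡ 1ℤ + + y * + p
      nx = trans (ℤ.*-comm (+ n) (+ x)) (trans (sym (pos-* x n))
             (trans (cong +_ (sym eq)) (cong (λ z → 1ℤ + z) (pos-* y p))))
      ring : ∀ z → 1ℤ + z - 1ℤ ≡ z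
      ring = solve-∀
    natural {n} (Bézout.-+ x y eq) = - + x ,
      divides (- + y) (trans (ring (+ n) (+ x)) (trans (cong -_ nx) (ring′ (+ y) (+ p))))
      where
      nx : 1ℤ + + x * + n ≡ + y * + p
      nx = trans (cong (λ z → 1ℤ + z) (sym (pos-* x n))) (trans (cong +_ eq) (pos-* y p))
      ring : ∀ n x → n * (- x) - 1ℤ ≡ - (1ℤ + x * n)
      ring = solve-∀
      ring′ : ∀ y p → - (y * p) ≡ - y * p
      ring′ = solve-∀
  ... | w , h with +∣i∣≡i⊎+∣i∣≡-i u
  ...   | inj₁ eq = w , ∣-resp-≡ (cong (λ z → z * w - 1ℤ) eq) h
  ...   | inj₂ eq = - w , ∣-resp-≡ (trans (cong (λ z → z * w - 1ℤ) eq) (ring u w)) h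
    where
    ring : ∀ u w → - u * w - 1ℤ ≡ u * - w - 1ℤ
    ring = solve-∀

  -- As `p` divides `a`, the derivative `2ax + b` is a unit modulo `p` at every `x`, so Newton's
  -- step always works and the induction can start at modulus 1.
  hensel : ∀ a b c → + p ∣ a → ¬ (+ p ∣ b) → ∀ k → ∃[ x ] (P k ∣ a * (x * x) + b * x + c)
  hensel a b c p∣a p∤b zero = 0ℤ , P-0-∣ _
  hensel a b c p∣a p∤b (suc k)
    with x , divides q eq ← hensel a b c p∣a p∤b k
    with w , h ← inverse-mod-p (+ 2 * a * x + b) (λ p∣S → p∤b (∣m+n∣m⇒∣n p∣S (∣m⇒∣m*n x (∣n⇒∣m*n (+ 2) p∣a)))) =
    -- Here `q * P k` is the present value and `w` inverts the derivative modulo `p`. The quadratic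
    -- term has the factor `a * P k * P k`, divisible by `P (suc k)` even for `k = 0` because `p`
    -- divides `a`.
    x + P k * - (q * w) ,
    ∣-resp-≡ (sym (trans (ring a b c x (P k) (q * w))
                  (trans (cong (_+ P k * (- (q * w) * (+ 2 * a * x + b) + a * (q * w * (q * w) * P k))) eq)
                    (ring′ q (P k) w (+ 2 * a * x + b) a))))
      (P-suc-scale k (∣m∣n⇒∣m+n (∣n⇒∣m*n (- q) h) (∣m⇒∣m*n (q * w * (q * w) * P k) p∣a)))
    where
    ring : ∀ a b c x A t → a * ((x + A * - t) * (x + A * - t)) + b * (x + A * - t) + c
         ≡ (a * (x * x) + b * x + c) + A * (- t * (+ 2 * a * x + b) + a * (t * t * A))
    ring = solve-∀
    ring′ : ∀ q A w S a → q * A + A * (- (q * w) * S + a * (q * w * (q * w) * A))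
          ≡ A * (- q * (S * w - 1ℤ) + a * (q * w * (q * w) * A))
    ring′ = solve-∀

  -- Obstructions and square roots of d.

  -- Obstruction p α β b d says that no square root of d modulo p ^ α is congruent to b modulo p ^ β.
  RootCongruentTo : (α β : ℕ) (b d : ℤ) → Set
  RootCongruentTo α β b d = ∃[ s ] ((s * s ≡ d [mod p ^ α ]) × (s ≡ b [mod p ^ β ]))

  -- A root `s` satisfies `p ^ α ∣ s * s`, hence is a multiple of `p ^ σ`, where `σ` is half of `α`
  -- rounded up.
  obstructionDiv⇒noRoot : ∀ α β {b d} → β ≤ α → ObstructionDiv p α β b d → ¬ RootCongruentTo α β b d
  obstructionDiv⇒noRoot α β {b} {d} β≤α (α∣d , σ , α≡ , obs) (s , s²≡d , s≡b) =
    absurd (P-∣-square⇒P-∣ σ s (2σ≤α+1 α≡) (∣-resp-≡ (x-y+y≡x (s * s) d) (∣m∣n⇒∣m+n s²≡d α∣d)))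
    where
    2σ≤α+1 : α ≡ 2 ℕ.* σ ⊎ suc α ≡ 2 ℕ.* σ → σ ℕ.+ σ ≤ suc α
    2σ≤α+1 (inj₁ e) = ℕ.≤-trans (ℕ.≤-reflexive (sym (trans e (double σ)))) (ℕ.n≤1+n α)
    2σ≤α+1 (inj₂ e) = ℕ.≤-reflexive (sym (trans e (double σ)))
    σ≤α : ∀ {σ} → α ≡ 2 ℕ.* σ ⊎ suc α ≡ 2 ℕ.* σ → σ ≤ α
    σ≤α {σ} (inj₁ e) = ℕ.≤-trans (ℕ.m≤m+n σ _) (ℕ.≤-reflexive (sym e))
    σ≤α {zero} (inj₂ e) = z≤n
    σ≤α {suc σ} (inj₂ e) =
      ℕ.≤-trans (ℕ.m≤m+n (suc σ) σ)
        (ℕ.≤-reflexive (sym (trans (ℕ.suc-injective (trans e (double (suc σ)))) (ℕ.+-suc σ σ))))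
    absurd : P σ ∣ s → ⊥
    -- Reducing `q` modulo `p ^ (α ∸ σ)` changes `s` by a multiple of `p ^ α`, hence of `p ^ β`.
    absurd (divides q refl) with j , r , j< , q≡ ← divMod-P (α ∸ σ) q =
      obs j j<
        (∣-resp-≡ (sym (eq j r q≡)) (∣m∣n⇒∣m-n s≡b (∣n⇒∣m*n r (P-mono β≤α))))
      where
      ring : ∀ j r A B b → j * B - b ≡ (j + r * A) * B - b - r * (A * B)
      ring = solve-∀
      eq : ∀ j r → q ≡ + j + r * P (α ∸ σ) → + (j ℕ.* p ^ σ) - b ≡ q * P σ - b - r * P α
      eq j r q≡ = trans (cong (_- b) (pos-* j (p ^ σ)))
        (trans (ring (+ j) r (P (α ∸ σ)) (P σ) b)
          (cong₂ (λ y z → y * P σ - b - r * z)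
            (sym q≡)
            (trans (sym (P-+ (α ∸ σ) σ)) (cong P (ℕ.m∸n+n≡m (σ≤α {σ} α≡))))))

  -- A root has the form `t * p ^ μ` with `t * t ≡ d₁` modulo `p ^ (α ∸ 2 * μ)`. Reducing `t` gives
  -- `σ`, and reducing the quotient modulo `p ^ μ` gives `j`.
  obstructionNonDiv⇒noRoot : ∀ α β {b d} → β ≤ α → ObstructionNonDiv p α β b d → ¬ RootCongruentTo α β b d
  obstructionNonDiv⇒noRoot α β {b} {d} β≤α (α∤d , μ , d₁ , (2μ∣d , _) , refl , obs) (s , s²≡d , s≡b)
    with o , refl ← ℕ.m≤n⇒∃[o]m+o≡n {2 ℕ.* μ} {α} (ℕ.≰⇒≥ (λ α≤2μ → α∤d (∣-trans (P-mono α≤2μ) 2μ∣d))) =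
    absurd (P-∣-square⇒P-∣ μ s (ℕ.≤-trans (ℕ.≤-reflexive (sym (double μ))) (ℕ.n≤1+n _))
             (∣-resp-≡ (x-y+y≡x (s * s) d) (∣m∣n⇒∣m+n (∣-trans (P-mono (ℕ.m≤m+n (2 ℕ.* μ) o)) s²≡d) 2μ∣d)))
    where
    α∸2μ≡o : 2 ℕ.* μ ℕ.+ o ∸ 2 ℕ.* μ ≡ o
    α∸2μ≡o = ℕ.m+n∸m≡n (2 ℕ.* μ) o
    α≡μ+[μ+o] : 2 ℕ.* μ ℕ.+ o ≡ μ ℕ.+ (μ ℕ.+ o)
    α≡μ+[μ+o] = trans (cong (ℕ._+ o) (double μ)) (ℕ.+-assoc μ μ o)
    α∸μ≡μ+o : 2 ℕ.* μ ℕ.+ o ∸ μ ≡ μ ℕ.+ o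
    α∸μ≡μ+o = trans (cong (_∸ μ) α≡μ+[μ+o]) (ℕ.m+n∸m≡n μ (μ ℕ.+ o))
    P-2μ : P (2 ℕ.* μ) ≡ P μ * P μ
    P-2μ = trans (cong P (double μ)) (P-+ μ μ)
    absurd : P μ ∣ s → ⊥
    absurd (divides t refl)
      with σ , q , σ< , t≡ ← divMod-P o t
      with j , r , j< , q≡ ← divMod-P μ q =
      obs σ j (subst (λ k → σ < p ^ k) (sym α∸2μ≡o) σ<)
        (subst (λ k → + σ * + σ ≡ d₁ [mod p ^ k ]) (sym α∸2μ≡o) (σ²≡d₁ (+ σ) q t≡))
        j<
        (subst (λ k → + (σ ℕ.* p ^ μ ℕ.+ j ℕ.* p ^ k) ≡ b [mod p ^ β ]) (sym α∸μ≡μ+o)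
          (∣-resp-≡ (sym (eq σ q j r t≡ q≡)) (∣m∣n⇒∣m-n s≡b (∣n⇒∣m*n r (P-mono β≤α)))))
      where
      ring₁ : ∀ t M d₁ → t * M * (t * M) - d₁ * (M * M) ≡ M * M * (t * t - d₁)
      ring₁ = solve-∀
      t²≡d₁ : P o ∣ t * t - d₁
      t²≡d₁ = P-cancel (2 ℕ.* μ) o (∣-resp-≡
        (trans (cong (λ z → t * P μ * (t * P μ) - d₁ * z) P-2μ)
          (trans (ring₁ t (P μ) d₁) (cong (_* (t * t - d₁)) (sym P-2μ)))) s²≡d)
      ring₂ : ∀ s q O d₁ → (s + q * O) * (s + q * O) - d₁ - q * (+ 2 * s + q * O) * O ≡ s * s - d₁
      ring₂ = solve-∀
      σ²≡d₁ : ∀ σ q → t ≡ σ + q * P o → P o ∣ σ * σ - d₁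
      σ²≡d₁ σ q t≡ = ∣-resp-≡
        (trans (cong (λ z → z * z - d₁ - q * (+ 2 * σ + q * P o) * P o) t≡) (ring₂ σ q (P o) d₁))
        (∣m∣n⇒∣m-n t²≡d₁ (∣n⇒∣m*n (q * (+ 2 * σ + q * P o)) ∣-refl))
      ring₃ : ∀ σ j r M O b → σ * M + j * (M * O) - b ≡ (σ + (j + r * M) * O) * M - b - r * (M * (M * O))
      ring₃ = solve-∀
      eq : ∀ σ q j r → t ≡ + σ + q * P o → q ≡ + j + r * P μ →
        + (σ ℕ.* p ^ μ ℕ.+ j ℕ.* p ^ (μ ℕ.+ o)) - b ≡ t * P μ - b - r * P (2 ℕ.* μ ℕ.+ o)
      eq σ q j r t≡ q≡ = trans
        (cong (_- b) (trans (pos-+ (σ ℕ.* p ^ μ) _)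
          (cong₂ _+_ (pos-* σ (p ^ μ)) (trans (pos-* j (p ^ (μ ℕ.+ o))) (cong (+ j *_) (P-+ μ o))))))
        (trans (ring₃ (+ σ) (+ j) r (P μ) (P o) b)
          (cong₂ (λ y z → y * P μ - b - r * z)
            (sym (trans t≡ (cong (λ z → + σ + z * P o) q≡)))
            (sym (trans (cong P α≡μ+[μ+o]) (trans (P-+ μ (μ ℕ.+ o)) (cong (P μ *_) (P-+ μ o)))))))

  obstruction⇒noRoot : ∀ α β {b d} → β ≤ α → Obstruction p α β b d → ¬ RootCongruentTo α β b d
  obstruction⇒noRoot α β β≤α = Sum.[ obstructionNonDiv⇒noRoot α β β≤α , obstructionDiv⇒noRoot α β β≤α ]

  -- With `σ` half of `α` rounded up, every multiple of `p ^ σ` is a square root of `d`, since its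
  -- square and `d` both vanish modulo `p ^ α`.
  noRoot⇒obstructionDiv : ∀ α β {b d} → P α ∣ d → ¬ RootCongruentTo α β b d → ObstructionDiv p α β b d
  noRoot⇒obstructionDiv α β {b} {d} α∣d noRoot = α∣d , half (parity α)
    where
    noMultiple : ∀ σ → α ≤ σ ℕ.+ σ → ∀ j → j < p ^ (α ∸ σ) → + (j ℕ.* p ^ σ) ≢ b [mod p ^ β ]
    noMultiple σ α≤2σ j _ h = noRoot (+ (j ℕ.* p ^ σ) ,
      ∣m∣n⇒∣m-n (∣-trans (P-mono α≤2σ) (P-∣⇒P-∣-square σ _ (divides (+ j) (pos-* j (p ^ σ))))) α∣d , h)
    half : ∃[ k ] (α ≡ k ℕ.+ k ⊎ α ≡ suc (k ℕ.+ k)) → _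
    half (k , inj₁ e) = k , inj₁ (trans e (sym (double k))) , noMultiple k (ℕ.≤-reflexive e)
    half (k , inj₂ e) = suc k , inj₂ suc-α , noMultiple (suc k)
      (ℕ.≤-trans (ℕ.n≤1+n α) (ℕ.≤-reflexive (trans suc-α (double (suc k)))))
      where
      suc-α : suc α ≡ 2 ℕ.* suc k
      suc-α = trans (cong suc (trans e (sym (ℕ.+-suc k k)))) (sym (double (suc k)))

  -- The root `t * P μ` with `t` prime to `p` fixes the multiplicity of `d` as `2 * μ`, because
  -- `suc o` keeps `2 * μ` below `α`. Every number listed in the obstruction is itself a root.
  root⇒obstructionNonDiv : ∀ β {b d} μ t o → ¬ (+ p ∣ t) →
    let α = 2 ℕ.* μ ℕ.+ suc o in
    t * P μ * (t * P μ) ≡ d [mod p ^ α ] → ¬ (P α ∣ d) → ¬ RootCongruentTo α β b d →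
    ObstructionNonDiv p α β b d
  root⇒obstructionNonDiv β {b} {d} μ t o′ p∤t (divides r s²-d≡) α∤d noRoot =
    α∤d , μ , d₁ , (divides d₁ d≡ , maximal) , d≡ , distinct
    where
    o = suc o′
    α = 2 ℕ.* μ ℕ.+ o
    M = P μ
    -- The quotient of `d` by `p ^ (2 * μ)`, read off from `s * s - d = r * P α` for `s = t * M`. It
    -- is `t * t` modulo `p`, hence prime to `p`.
    d₁ = t * t - r * P o
    α≡μ+[μ+o] : α ≡ μ ℕ.+ (μ ℕ.+ o)
    α≡μ+[μ+o] = trans (cong (ℕ._+ o) (double μ)) (ℕ.+-assoc μ μ o)
    P-α : P α ≡ M * (M * P o)
    P-α = trans (cong P α≡μ+[μ+o]) (trans (P-+ μ (μ ℕ.+ o)) (cong (M *_) (P-+ μ o)))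
    P-2μ : P (2 ℕ.* μ) ≡ M * M
    P-2μ = trans (cong P (double μ)) (P-+ μ μ)
    ring₁ : ∀ t M r O → t * M * (t * M) - r * (M * (M * O)) ≡ (t * t - r * O) * (M * M)
    ring₁ = solve-∀
    d≡ : d ≡ d₁ * P (2 ℕ.* μ)
    d≡ = trans (sym (x-[x-y]≡y (t * M * (t * M)) d))
      (trans (cong (λ z → t * M * (t * M) - z) (trans s²-d≡ (cong (r *_) P-α)))
        (trans (ring₁ t M r (P o)) (cong (d₁ *_) (sym P-2μ))))
    maximal : ∀ k → P k ∣ d → k ≤ 2 ℕ.* μ
    maximal k k∣d = ℕ.≮⇒≥ (λ 2μ<k → p∤t (p∣x²⇒p∣x t (∣-resp-≡ (x-y+y≡x (t * t) (r * P o))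
      (∣m∣n⇒∣m+n
        (P-suc-cancel (2 ℕ.* μ) (∣-resp-≡ (trans d≡ (ℤ.*-comm d₁ (P (2 ℕ.* μ)))) (∣-trans (P-mono 2μ<k) k∣d)))
        (∣n⇒∣m*n r (p∣P {o} (s≤s z≤n)))))))
    distinct : ∀ σ j → σ < p ^ (α ∸ 2 ℕ.* μ) → (+ σ * + σ ≡ d₁ [mod p ^ (α ∸ 2 ℕ.* μ) ]) → j < p ^ μ →
      + (σ ℕ.* p ^ μ ℕ.+ j ℕ.* p ^ (α ∸ μ)) ≢ b [mod p ^ β ]
    distinct σ j _ σ²≡d₁ _ h = noRoot (+ (σ ℕ.* p ^ μ ℕ.+ j ℕ.* p ^ (α ∸ μ)) , square , h)
      where
      value : + (σ ℕ.* p ^ μ ℕ.+ j ℕ.* p ^ (α ∸ μ)) ≡ + σ * M + + j * (M * P o)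
      value = trans (cong (λ k → + (σ ℕ.* p ^ μ ℕ.+ j ℕ.* p ^ k))
                (trans (cong (_∸ μ) α≡μ+[μ+o]) (ℕ.m+n∸m≡n μ (μ ℕ.+ o))))
        (trans (pos-+ (σ ℕ.* p ^ μ) _)
          (cong₂ _+_ (pos-* σ (p ^ μ)) (trans (pos-* j (p ^ (μ ℕ.+ o))) (cong (+ j *_) (P-+ μ o)))))
      ring₂ : ∀ σ j M O d₁ → (σ * M + j * (M * O)) * (σ * M + j * (M * O)) - d₁ * (M * M)
            ≡ M * M * (σ * σ - d₁ + (+ 2 * σ * j + j * j * O) * O)
      ring₂ = solve-∀
      square : P α ∣ + (σ ℕ.* p ^ μ ℕ.+ j ℕ.* p ^ (α ∸ μ)) * + (σ ℕ.* p ^ μ ℕ.+ j ℕ.* p ^ (α ∸ μ)) - d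
      square = ∣-resp-≡
        (sym (trans (cong₂ (λ y z → y * y - z) value (trans d≡ (cong (d₁ *_) P-2μ)))
          (trans (ring₂ (+ σ) (+ j) M (P o) d₁)
            (cong (_* (+ σ * + σ - d₁ + (+ 2 * + σ * + j + + j * + j * P o) * P o)) (sym P-2μ)))))
        (P-scale (2 ℕ.* μ) o (∣m∣n⇒∣m+n
          (subst (λ k → + σ * + σ ≡ d₁ [mod p ^ k ]) (ℕ.m+n∸m≡n (2 ℕ.* μ) o) σ²≡d₁)
          (∣n⇒∣m*n (+ 2 * + σ * + j + + j * + j * P o) ∣-refl)))

  -- A root `s` is factored as `t * P μ` with `t` prime to `p`. Either of `P α ∣ s` and `α ≤ 2 * μ`
  -- would make `p ^ α` divide `d`.
  noRoot⇒obstructionNonDiv : ∀ α β {b d} → ¬ (P α ∣ d) → QuadraticResidue d (p ^ α) →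
    ¬ RootCongruentTo α β b d → ObstructionNonDiv p α β b d
  noRoot⇒obstructionNonDiv α β {d = d} α∤d (s , s²≡d) noRoot
    with μ , t , refl , p∤t ← p-adic-factorisation α s
           (λ α∣s → α∤d (∣-resp-≡ (x-[x-y]≡y (s * s) d) (∣m∣n⇒∣m-n (∣m⇒∣m*n s α∣s) s²≡d)))
    with o , eq ← ℕ.m≤n⇒∃[o]m+o≡n {suc (2 ℕ.* μ)} {α} (ℕ.≰⇒> (λ α≤2μ → α∤d (∣-resp-≡ (x-[x-y]≡y (t * P μ * (t * P μ)) d)
           (∣m∣n⇒∣m-n (∣-trans (P-mono (ℕ.≤-trans α≤2μ (ℕ.≤-reflexive (double μ))))
                        (P-∣⇒P-∣-square μ (t * P μ) (divides t refl))) s²≡d))))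
    with refl ← trans (ℕ.+-suc (2 ℕ.* μ) o) eq =
    root⇒obstructionNonDiv β μ t o p∤t s²≡d α∤d noRoot

  noRoot⇒obstruction : ∀ α β {b d} → QuadraticResidue d (p ^ α) →
    ¬ RootCongruentTo α β b d → Obstruction p α β b d
  noRoot⇒obstruction α β {d = d} residue noRoot with P α ∣? d
  ... | yes α∣d = inj₂ (noRoot⇒obstructionDiv α β α∣d noRoot)
  ... | no α∤d = inj₁ (noRoot⇒obstructionNonDiv α β α∤d residue noRoot)

  -- Validity of IQF as a lifting property.

  module Reduction (2∤p : 2 ∤ⁿ p) (a′ b c : ℤ) (p∤a′ : ¬ (+ p ∣ a′)) (l m : ℕ) (1≤l : 1 ≤ l) (1≤m : 1 ≤ m) where

    a d : ℤ
    a = a′ * P l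
    d = disc a b c

    f S : ℤ → ℤ
    f x = a * (x * x) + b * x + c
    S x = + 2 * a * x + b

    Lifts : Set
    Lifts = ∀ x → P m ∣ f x → P (l ℕ.+ m) ∣ f x

    p∤2 : ¬ (+ p ∣ + 2)
    p∤2 h = 2∤p (subst (_∣ⁿ p) (ℕ.≤-antisym (∣ⁿ⇒≤ (∣⇒∣ᵤ h)) 1<p) (dividesⁿ 1 (sym (ℕ.*-identityˡ p))))

    p∤4 : ¬ (+ p ∣ + 4)
    p∤4 h = p∤2 (p∣x²⇒p∣x (+ 2) h)

    p∤2a′ : ¬ (+ p ∣ + 2 * a′)
    p∤2a′ h = p∤a′ (p∤u∧p∣u*z⇒p∣z (+ 2) a′ p∤2 h)

    p∣a : + p ∣ a
    p∣a = ∣n⇒∣m*n a′ (p∣P {l} 1≤l)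

    square-completion : ∀ x → S x * S x - d ≡ P l * (+ 4 * (a′ * f x))
    square-completion x = ring a′ (P l) b c x
      where
      ring : ∀ a′ A b c x →
        (+ 2 * (a′ * A) * x + b) * (+ 2 * (a′ * A) * x + b) - (b * b - + 4 * (a′ * A) * c)
        ≡ A * (+ 4 * (a′ * (a′ * A * (x * x) + b * x + c)))
      ring = solve-∀

    -- In `square-completion` the factor `4 * a′` is prime to `p`, so only `P l` shifts the
    -- exponent.
    square≡disc⇒P-∣-f : ∀ n x → P (l ℕ.+ n) ∣ S x * S x - d → P n ∣ f x
    square≡disc⇒P-∣-f n x h =
      P-coprime-cancel a′ n p∤a′ (P-coprime-cancel (+ 4) n p∤4
        (P-cancel l n (∣-resp-≡ (square-completion x) h)))

    P-∣-f⇒square≡disc : ∀ n x → P n ∣ f x → P (l ℕ.+ n) ∣ S x * S x - d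
    P-∣-f⇒square≡disc n x h =
      ∣-resp-≡ (sym (square-completion x)) (P-scale l n (∣n⇒∣m*n (+ 4) (∣n⇒∣m*n a′ h)))

    S≡root⇒P-∣-f : ∀ x s → P (l ℕ.+ m) ∣ S x - s → P (l ℕ.+ m) ∣ s * s - d → P m ∣ f x
    S≡root⇒P-∣-f x s S≡s s²≡d = square≡disc⇒P-∣-f m x
      (∣-resp-≡ (ring (S x) s d) (∣m∣n⇒∣m+n (∣m⇒∣m*n (S x + s) S≡s) s²≡d))
      where
      ring : ∀ S s d → (S - s) * (S + s) + (s * s - d) ≡ S * S - d
      ring = solve-∀

    S-x≡ : ∀ x → P (l ℕ.+ m) ∣ + 2 * a * x - (- b + S x)
    S-x≡ x = divides 0ℤ (ring (+ 2 * a * x) b)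
      where
      ring : ∀ y b → y - (- b + (y + b)) ≡ 0ℤ
      ring = solve-∀

    -- The choice `s = S x` solves the linear congruence exactly, and it is a root of `d` as soon as
    -- `P m ∣ f x`.
    valid⇒lifts : IQFValid a b c (p ^ (l ℕ.+ m)) → Lifts
    valid⇒lifts valid x h = ∣-resp-≡ (ℤ.+-identityʳ (f x)) (Equivalence.from (valid x)
      (S x , P-∣-f⇒square≡disc m x h , S-x≡ x))

    lifts⇒valid : Lifts → IQFValid a b c (p ^ (l ℕ.+ m))
    lifts⇒valid lifts x = mk⇔ root solution
      where
      Root : Set
      Root = ∃[ s ] ((s * s ≡ d [mod p ^ (l ℕ.+ m) ]) × (+ 2 * a * x ≡ - b + s [mod p ^ (l ℕ.+ m) ]))
      root : f x ≡ 0ℤ [mod p ^ (l ℕ.+ m) ] → Root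
      root h = S x , P-∣-f⇒square≡disc m x (∣-trans (P-mono (ℕ.m≤n+m m l)) (∣-resp-≡ (ℤ.+-identityʳ (f x)) h)) , S-x≡ x
      ring : ∀ y b s → y - (- b + s) ≡ y + b - s
      ring = solve-∀
      solution : Root → f x ≡ 0ℤ [mod p ^ (l ℕ.+ m) ]
      solution (s , s²≡d , S≡s) = ∣-resp-≡ (sym (ℤ.+-identityʳ (f x)))
        (lifts x (S≡root⇒P-∣-f x s (∣-resp-≡ (ring (+ 2 * a * x) b s) S≡s) s²≡d))

    solution⇒root : ∀ x → P m ∣ f x → RootCongruentTo (l ℕ.+ m) l b d
    solution⇒root x h = S x , P-∣-f⇒square≡disc m x h ,
      divides (+ 2 * a′ * x) (ring a′ (P l) x b)
      where
      ring : ∀ a′ A x b → + 2 * (a′ * A) * x + b - b ≡ + 2 * a′ * x * A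
      ring = solve-∀

    -- Writing `s - b = r * P l` turns `S x ≡ s` into `2 * a′ * x ≡ r` modulo `p ^ m`, which
    -- `hensel` solves with leading coefficient 0.
    root⇒solution : RootCongruentTo (l ℕ.+ m) l b d → ∃[ x ] (P m ∣ f x)
    root⇒solution (s , s²≡d , divides r s-b≡)
      with x , h ← hensel 0ℤ (+ 2 * a′) (- r) (divides 0ℤ refl) p∤2a′ m =
      x , S≡root⇒P-∣-f x s (∣-resp-≡ eq (P-scale l m h)) s²≡d
      where
      ring : ∀ a′ A x r b → A * (0ℤ * (x * x) + + 2 * a′ * x + - r) ≡ + 2 * (a′ * A) * x + b - (r * A + b)
      ring = solve-∀
      eq : P l * (0ℤ * (x * x) + + 2 * a′ * x + - r) ≡ S x - s
      eq = trans (ring a′ (P l) x r b)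
        (cong (λ z → S x - z) (trans (cong (_+ b) (sym s-b≡)) (x-y+y≡x s b)))

    -- Consequences of lifting when a solution exists.

    module Solution (lifts : Lifts) (x : ℤ) (P-m∣f : P m ∣ f x) where

      P-l+m∣f : P (l ℕ.+ m) ∣ f x
      P-l+m∣f = lifts x P-m∣f

      increment-lifts : ∀ h → P m ∣ h * (S x + a * h) → P (l ℕ.+ m) ∣ h * (S x + a * h)
      increment-lifts h h∣ = ∣m+n∣m⇒∣n
        (∣-resp-≡ (shift a b c x h) (lifts (x + h) (∣-resp-≡ (sym (shift a b c x h)) (∣m∣n⇒∣m+n P-m∣f h∣))))
        P-l+m∣f
        where
        shift : ∀ a b c x h → a * ((x + h) * (x + h)) + b * (x + h) + c
              ≡ a * (x * x) + b * x + c + h * (+ 2 * a * x + b + a * h)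
        shift = solve-∀

      -- Opaque, as normalising the witness S′ would unfold this whole proof.
      abstract
        P-l∣S : P l ∣ S x
        P-l∣S = ∣m+n∣n⇒∣m {m = S x} {n = a * P m}
          (P-cancel m l (∣-resp-≡ˡ _ (cong P (ℕ.+-comm l m)) (increment-lifts (P m) (P-∣-P* m (S x + a * P m)))))
          (∣m⇒∣m*n (P m) (∣n⇒∣m*n a′ ∣-refl))

      p∣b : + p ∣ b
      p∣b = ∣m+n∣m⇒∣n {m = + 2 * a * x} (∣-trans (p∣P 1≤l) P-l∣S) (∣m⇒∣m*n x (∣n⇒∣m*n (+ 2) p∣a))

      S′ : ℤ
      S′ = _∣_.quotient P-l∣S

      S≡S′*P-l : S x ≡ S′ * P l
      S≡S′*P-l = _∣_.equality P-l∣S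

      -- Multiplied by `P l`, the product is an increment of `f`, divisible by `p ^ m` because
      -- `m ≤ l + N`. Lifting it and cancelling `P l` leaves `p ^ m`, and `N < m`.
      valuation-gap : ∀ N → m ≤ l ℕ.+ N → N < m → ∀ h → P N ∣ h * (S′ + a′ * h) → P (suc N) ∣ h * (S′ + a′ * h)
      valuation-gap N m≤l+N N<m h h∣ = ∣-trans (P-mono N<m)
        (P-cancel l m (∣-resp-≡ eq (increment-lifts h (∣-resp-≡ (sym eq)
          (∣-trans (P-mono m≤l+N) (P-scale l N h∣))))))
        where
        ring : ∀ h S′ a′ A → h * (S′ * A + a′ * A * h) ≡ A * (h * (S′ + a′ * h))
        ring = solve-∀
        eq : h * (S x + a * h) ≡ P l * (h * (S′ + a′ * h))
        eq = trans (cong (λ z → h * (z + a * h)) S≡S′*P-l) (ring h S′ a′ (P l))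

      -- The choice `h = A * B` turns the product into `P N * (q + a′ * A)`, so the gap gives
      -- `p ∣ q + a′ * A`.
      valuation-gap⇒p∣q : ∀ N → m ≤ l ℕ.+ N → N < m → ∀ A B q → + p ∣ A → P N ≡ A * (B * B) → S′ ≡ q * B → + p ∣ q
      valuation-gap⇒p∣q N m≤l+N N<m A B q p∣A P-N≡ S′≡ = ∣m+n∣n⇒∣m {m = q} {n = a′ * A}
        (P-suc-cancel N {q + a′ * A} (∣-resp-≡ eq
          (valuation-gap N m≤l+N N<m (A * B) (∣-resp-≡ (sym eq) (P-∣-P* N (q + a′ * A))))))
        (∣n⇒∣m*n a′ p∣A)
        where
        ring : ∀ A B q a′ → A * B * (q * B + a′ * (A * B)) ≡ A * (B * B) * (q + a′ * A)
        ring = solve-∀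
        eq : A * B * (S′ + a′ * (A * B)) ≡ P N * (q + a′ * A)
        eq = trans (cong (λ z → A * B * (z + a′ * (A * B))) S′≡)
               (trans (ring A B q a′) (cong (_* (q + a′ * A)) (sym P-N≡)))

      -- Each step gains one factor `p` of `S′` from `h = p ^ (N - j)`. It works while `2j < N`,
      -- when `A = p ^ (N - 2j)` is still divisible by `p`; so `j` reaches half of `N` rounded up.
      valuation-gap⇒P-∣-S′ : ∀ N → m ≤ l ℕ.+ N → N < m → ∀ j → j ℕ.+ j ≤ suc N → P j ∣ S′
      valuation-gap⇒P-∣-S′ N m≤l+N N<m zero _ = P-0-∣ S′
      valuation-gap⇒P-∣-S′ N m≤l+N N<m (suc j) 2j+2≤N+1
        with 2j<N ← subst (_≤ N) (ℕ.+-suc j j) (s≤s⁻¹ 2j+2≤N+1)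
        with divides q S′≡ ← valuation-gap⇒P-∣-S′ N m≤l+N N<m j (ℕ.≤-trans (ℕ.<⇒≤ 2j<N) (ℕ.n≤1+n N)) =
        ∣-resp-≡ (trans (ℤ.*-comm (P j) q) (sym S′≡)) (P-suc-scale j
          (valuation-gap⇒p∣q N m≤l+N N<m (P (N ∸ (j ℕ.+ j))) (P j) q (p∣P (ℕ.m<n⇒0<n∸m 2j<N)) P-N≡ S′≡))
        where
        P-N≡ : P N ≡ P (N ∸ (j ℕ.+ j)) * (P j * P j)
        P-N≡ = trans (cong P (sym (ℕ.m∸n+n≡m {N} {j ℕ.+ j} (ℕ.<⇒≤ 2j<N))))
          (trans (P-+ (N ∸ (j ℕ.+ j)) (j ℕ.+ j)) (cong (P (N ∸ (j ℕ.+ j)) *_) (P-+ j j)))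

      -- With `S′ = q * P k`, the choice `h = P k * t` gives `p ∣ t * (q + a′ * t)`. Since `p` is
      -- odd, `t = 1` and `t = 2` together give `p ∣ a′`.
      no-even-gap : ∀ k → m ≤ l ℕ.+ (k ℕ.+ k) → ¬ (k ℕ.+ k < m)
      no-even-gap k m≤l+2k 2k<m
        with divides q S′≡ ← valuation-gap⇒P-∣-S′ (k ℕ.+ k) m≤l+2k 2k<m k (ℕ.n≤1+n (k ℕ.+ k)) =
        p∤a′ (∣-resp-≡ (ring₂ q a′) (∣m∣n⇒∣m-n
          (p∤u∧p∣u*z⇒p∣z (+ 2) (q + a′ * + 2) p∤2 (p∣t*[q+a′t] (+ 2)))
          (∣-resp-≡ (ℤ.*-identityˡ (q + a′ * 1ℤ)) (p∣t*[q+a′t] 1ℤ))))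
        where
        ring₁ : ∀ B t q a′ → B * t * (q * B + a′ * (B * t)) ≡ B * B * (t * (q + a′ * t))
        ring₁ = solve-∀
        ring₂ : ∀ q a′ → q + a′ * + 2 - (q + a′ * 1ℤ) ≡ a′
        ring₂ = solve-∀
        p∣t*[q+a′t] : ∀ t → + p ∣ t * (q + a′ * t)
        p∣t*[q+a′t] t = P-suc-cancel (k ℕ.+ k) {t * (q + a′ * t)} (∣-resp-≡ eq (valuation-gap (k ℕ.+ k) m≤l+2k 2k<m (P k * t)
          (∣-resp-≡ (sym eq) (P-∣-P* (k ℕ.+ k) (t * (q + a′ * t))))))
          where
          eq : P k * t * (S′ + a′ * (P k * t)) ≡ P (k ℕ.+ k) * (t * (q + a′ * t))
          eq = trans (cong (λ z → P k * t * (z + a′ * (P k * t))) S′≡)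
                 (trans (ring₁ (P k) t q a′) (cong (_* (t * (q + a′ * t))) (sym (P-+ k k))))

      -- An even number lies in the gap: `m - 1` if `m` is odd, and `m - 2` if `m` is even, which is
      -- where `1 < l` enters.
      ¬1<l : ¬ (1 < l)
      ¬1<l 1<l with parity m
      ... | zero , inj₁ refl = contradiction 1≤m λ ()
      ... | suc k , inj₁ refl = no-even-gap k
        (ℕ.≤-trans (ℕ.≤-reflexive (cong suc (ℕ.+-suc k k))) (ℕ.+-monoˡ-≤ (k ℕ.+ k) 1<l))
        (s≤s (ℕ.+-monoʳ-≤ k (ℕ.n≤1+n k)))
      ... | k , inj₂ refl = no-even-gap k (ℕ.+-monoˡ-≤ (k ℕ.+ k) 1≤l) ℕ.≤-refl

      m-even : ∃[ k ] (m ≡ k ℕ.+ k)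
      m-even with parity m
      ... | k , inj₁ m≡2k = k , m≡2k
      ... | k , inj₂ refl = contradiction ℕ.≤-refl (no-even-gap k (ℕ.+-monoˡ-≤ (k ℕ.+ k) 1≤l))

      -- For `m = 2k > 0`, the gap at the odd number `m - 1` yields `P k ∣ S′` thanks to the
      -- rounding up.
      P-m∣S′² : l ≡ 1 → P m ∣ S′ * S′
      P-m∣S′² l≡1 with m-even
      ... | zero , refl = P-0-∣ _
      ... | k@(suc k′) , refl = P-∣⇒P-∣-square k S′
        (valuation-gap⇒P-∣-S′ (k′ ℕ.+ k) (ℕ.+-monoˡ-≤ (k′ ℕ.+ k) 1≤l) ℕ.≤-refl k ℕ.≤-refl)

      p∣c : + p ∣ c
      p∣c = ∣m+n∣m⇒∣n {m = a * (x * x) + b * x} (∣-trans (p∣P 1≤m) P-m∣f)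
        (∣m∣n⇒∣m+n (∣m⇒∣m*n (x * x) p∣a) (∣m⇒∣m*n x p∣b))

      -- Both `S x * S x` and `S x * S x - d` are divisible by `p ^ (m + 2)`: the first equals
      -- `P 2 * (S′ * S′)`, the second is `4 * a * f x` with `P (l + m) ∣ f x`.
      P-1+l+m∣d : l ≡ 1 → P (suc (l ℕ.+ m)) ∣ d
      P-1+l+m∣d refl = ∣-resp-≡ (x-[x-y]≡y (S x * S x) d) (∣m∣n⇒∣m-n
        (∣-resp-≡ (sym S²≡) (P-scale 2 m (P-m∣S′² refl)))
        (P-∣-f⇒square≡disc (suc m) x P-l+m∣f))
        where
        ring : ∀ S A → S * A * (S * A) ≡ A * A * (S * S)
        ring = solve-∀
        S²≡ : S x * S x ≡ P 2 * (S′ * S′)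
        S²≡ = trans (cong (λ z → z * z) S≡S′*P-l) (trans (ring S′ (P 1)) (cong (_* (S′ * S′)) (sym (P-+ 1 1))))

    -- The exceptional case and the equivalence.

    -- Parity gains the missing factor: `p ^ (2k + 1)` divides `S x * S x`, hence so does
    -- `p ^ (2k + 2)`, and it divides `d` as well.
    P-1+l+m∣d⇒lifts : l ≡ 1 → ∀ k → m ≡ k ℕ.+ k → P (suc (l ℕ.+ m)) ∣ d → Lifts
    P-1+l+m∣d⇒lifts refl k refl d∣ x P-m∣f = square≡disc⇒P-∣-f (suc (k ℕ.+ k)) x
      (∣m∣n⇒∣m-n
        (∣-resp-≡ˡ _ (cong P (cong suc (ℕ.+-suc k k))) (P-∣⇒P-∣-square (suc k) (S x)
          (P-∣-square⇒P-∣ (suc k) {suc (k ℕ.+ k)} (S x) (ℕ.≤-reflexive (cong suc (ℕ.+-suc k k)))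
            (∣-resp-≡ (x-y+y≡x (S x * S x) d)
              (∣m∣n⇒∣m+n (P-∣-f⇒square≡disc (k ℕ.+ k) x P-m∣f) (∣-trans (P-mono (ℕ.n≤1+n (suc (k ℕ.+ k)))) d∣))))))
        d∣)

    -- As `p` divides `a` and `b`, it divides `d`; every root of `d` is then 0 modulo `p`, like `b`.
    residue⇒root : l ≡ 1 → + p ∣ b → QuadraticResidue d (p ^ (l ℕ.+ m)) → RootCongruentTo (l ℕ.+ m) l b d
    residue⇒root refl p∣b (s , s²≡d) = s , s²≡d , ∣-resp-≡ˡ _ (sym P-1) (∣m∣n⇒∣m-n p∣s p∣b)
      where
      p∣d : + p ∣ d
      p∣d = ∣m∣n⇒∣m-n (∣m⇒∣m*n b p∣b) (∣m⇒∣m*n c (∣n⇒∣m*n (+ 4) p∣a))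
      p∣s : + p ∣ s
      p∣s = p∣x²⇒p∣x s (∣-resp-≡ (x-y+y≡x (s * s) d) (∣m∣n⇒∣m+n (∣-trans (p∣P {l ℕ.+ m} (s≤s z≤n)) s²≡d) p∣d))

    p∤b⇒solution : ¬ (+ p ∣ b) → ∃[ x ] (P m ∣ f x)
    p∤b⇒solution p∤b = hensel a b c p∣a p∤b m

    i = l ℕ.+ m

    Exceptional : Set
    Exceptional = l ≡ 1 × (2 ∤ⁿ i) × (+ p ∣ b) × (+ p ∣ c) × (+ (p ^ suc i) ∣ d)

    Obstructed : Set
    Obstructed = 1 < l × (+ p ∣ b) × Obstruction p i l b d

    valid⇒conditions : IQFValid a b c (p ^ i) →
      QuadraticNonResidue d (p ^ i) ⊎ (QuadraticResidue d (p ^ i) × ExactlyOne Obstructed Exceptional)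
    valid⇒conditions valid with quadraticResidue? d (p ^ i) {{p^k≢0 i}}
    ... | no nonResidue = inj₁ nonResidue
    ... | yes residue = inj₂ (residue , oneOf , λ ((1<l , _) , (l≡1 , _)) → ℕ.<-irrefl (sym l≡1) 1<l)
      where
      lifts : Lifts
      lifts = valid⇒lifts valid
      p∣b : + p ∣ b
      p∣b with + p ∣? b
      ... | yes h = h
      -- Hensel lifting produces a solution here, and lifting at a solution forces `p ∣ b`.
      ... | no p∤b = let x , h = p∤b⇒solution p∤b in Solution.p∣b lifts x h
      obstructed : 1 < l → Obstructed
      obstructed 1<l = 1<l , p∣b , noRoot⇒obstruction i l residue
        (λ root → let x , h = root⇒solution root in Solution.¬1<l lifts x h 1<l)
      exceptional : l ≡ 1 → Exceptional
      exceptional l≡1 =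
        let x , h = root⇒solution (residue⇒root l≡1 p∣b residue)
            open Solution lifts x h using (p∣c; P-1+l+m∣d; m-even)
            k , m≡2k = m-even
        in l≡1 , subst (2 ∤ⁿ_) (sym (cong₂ ℕ._+_ l≡1 m≡2k)) (2∤suc-double k) , p∣b , p∣c , P-1+l+m∣d l≡1
      oneOf : Obstructed ⊎ Exceptional
      oneOf = Sum.map obstructed (λ 1≡l → exceptional (sym 1≡l)) (ℕ.m≤n⇒m<n∨m≡n 1≤l)

    conditions⇒valid :
      QuadraticNonResidue d (p ^ i) ⊎ (QuadraticResidue d (p ^ i) × ExactlyOne Obstructed Exceptional) →
      IQFValid a b c (p ^ i)
    -- No `x` satisfies `P m ∣ f x`, so `Lifts` holds vacuously; the same happens in the obstructed
    -- case.
    conditions⇒valid (inj₁ nonResidue) = lifts⇒valid λ x h →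
      let s , s²≡d , _ = solution⇒root x h in contradiction (s , s²≡d) nonResidue
    conditions⇒valid (inj₂ (_ , inj₁ (_ , _ , obstruction) , _)) = lifts⇒valid λ x h →
      contradiction (solution⇒root x h) (obstruction⇒noRoot i l (ℕ.m≤m+n l m) obstruction)
    conditions⇒valid (inj₂ (_ , inj₂ (l≡1 , 2∤i , _ , _ , d∣) , _)) with parity m
    ... | k , inj₁ m≡2k = lifts⇒valid (P-1+l+m∣d⇒lifts l≡1 k m≡2k d∣)
    ... | k , inj₂ m≡2k+1 = contradiction
      (subst (2 ∣ⁿ_) (sym (trans (cong₂ ℕ._+_ l≡1 m≡2k+1) (cong suc (sym (ℕ.+-suc k k))))) (2∣double (suc k))) 2∤i

  -- If `p` divided `a′`, then `p ^ suc l` would be a common divisor of `a` and `p ^ i` exceeding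
  -- their gcd.
  gcd≡P⇒factor : ∀ a i l → l < i → gcd a (P i) ≡ P l → ∃[ a′ ] (a ≡ a′ * P l × ¬ (+ p ∣ a′))
  gcd≡P⇒factor a i l l<i eq with divides a′ a≡ ← ∣ᵤ⇒∣ {P l} {a} (subst (λ g → ∣ g ∣ ∣ⁿ ∣ a ∣) eq (gcd[i,j]∣i a (P i))) =
    a′ , a≡ , λ p∣a′ → ℕ.<⇒≱ (ℕ.^-monoʳ-< p 1<p (ℕ.n<1+n l))
      (∣ⁿ⇒≤ {{p^k≢0 l}} (subst (λ g → p ^ suc l ∣ⁿ ∣ g ∣) eq
        (gcd-greatest {a} {P i} {P (suc l)}
          (∣⇒∣ᵤ {P (suc l)} {a} (∣-resp-≡ (trans (ℤ.*-comm (P l) a′) (sym a≡)) (P-suc-scale l p∣a′)))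
          (∣⇒∣ᵤ {P (suc l)} {P i} (P-mono l<i)))))

corollary6p2 : (a b c : ℤ) (p i l : ℕ) →
    Prime p → 2 ∤ⁿ p → 2 ≤ i →
    gcd a (+ (p ^ i)) ≡ + (p ^ l) → 1 ≤ l → l < i →
    let d = disc a b c in
    IQFValid a b c (p ^ i)
    ⇔ ( QuadraticNonResidue d (p ^ i)
      ⊎ ( QuadraticResidue d (p ^ i)
        × ExactlyOne
            ( 1 < l
            × (+ p ∣ b)
            × Obstruction p i l b d )
            ( l ≡ 1
            × (2 ∤ⁿ i)
            × (+ p ∣ b)
            × (+ p ∣ c)
            × (+ (p ^ suc i) ∣ d) ) ) )
corollary6p2 a b c p i l p-prime 2∤p _ gcd≡ 1≤l l<i
  with a′ , refl , p∤a′ ← PrimePowers.gcd≡P⇒factor p-prime a i l l<i gcd≡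
  with m , refl ← ℕ.m≤n⇒∃[o]m+o≡n {l} {i} (ℕ.<⇒≤ l<i) =
  mk⇔ valid⇒conditions conditions⇒valid
  where
  1≤m : 1 ≤ m
  1≤m = ℕ.+-cancelˡ-< l 0 m (subst (_< l ℕ.+ m) (sym (ℕ.+-identityʳ l)) l<i)
  open PrimePowers.Reduction p-prime 2∤p a′ b c p∤a′ l m 1≤l 1≤m
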